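{- Let $n\ge2$ and let $S=P_{j_1}(A_{i_1})P_{j_2}(A_{i_2})\cdots P_{j_r}(A_{i_r})$ with $r\ge1$, all $j_\ell\ge1$, $i_\ell\ne i_{\ell+1}$ for all $\ell$, and $i_1\ne1\ne i_r$. For integers $a,b$ put $S_{a,b}=P_a(A_1)SP_b(A_1)$ (with $P_{ -1}=0$), $v_{a,b}=[S_{a,b},A_1]$, $e_{a,b}=\frac1{\sqrt2}(S_{a,b}+S_{b,a})$ for $a<b$, $e_{a,a}=S_{a,a}$, and $w_{a,b}=\frac1{\sqrt2}(v_{a,b}-v_{b,a})$ for $a<b$; all operators are regarded as vectors of $\mathfrak F$ via $x\mapsto x[\Omega]$. For $m\ge1$ let $W^{2m-1}_S$ be the span of the $w_{a,b}$ with $0\le a<b$, $a+b$ odd and $a+b\le 2m-1$, and let $$s_m=\frac1{2m+3}\sum_{k=0}^{m-1}(m-k)\big([S_{k,k+1},A_1]-[S_{k+1,k},A_1]\big).$$ Then $s_m$ is the orthogonal projection of $S$ onto $W^{2m-1}_S$.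
   Context: Let $H$ be an $n$-dimensional complex inner product space with orthonormal basis $e_1,\dots,e_n$; the full Fock space $\mathfrak F$ is the Hilbert space completion of $\mathbb C\Omega\oplus\bigoplus_{d\ge1}H^{\otimes d}$, with $\|\Omega\|=1$ and tensors of basis vectors orthonormal. The creation operator is $c_i[v]=e_i\otimes v$, with adjoint $c_i^*[\Omega]=0$, $c_i^*[v_1\otimes\cdots\otimes v_d]=\langle e_i|v_1\rangle v_2\otimes\cdots\otimes v_d$, and $A_i=c_i+c_i^*$. The Chebyshev polynomials $P_k$ are defined by $P_0(x)=1$, $P_1(x)=x$, $xP_k(x)=P_{k+1}(x)+P_{k-1}(x)$ (so $P_k(A_i)[\Omega]=e_i^{\otimes k}$). $[X,Y]=XY-YX$. -}

module Defs where

open import Data.Nat as ℕ using (ℕ; zero; suc; _∸_; _<_; _≤_; _%_)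
open import Data.Integer using (+_)
open import Data.Rational using (ℚ; 0ℚ; 1ℚ; _/_; -_) renaming (_+_ to _+ℚ_; _*_ to _*ℚ_)
open import Data.Fin as Fin using (Fin)
open import Data.List using (List; []; _∷_; _++_; map; concatMap)
import Data.List.Properties as LP
open import Data.Product using (_×_; _,_; proj₁; proj₂; ∃)
open import Relation.Nullary using (yes; no; ¬_)
open import Relation.Binary.PropositionalEquality using (_≡_; _≢_)

-- Words (basis tensors e_{w1}⊗...⊗e_{wd}); [] is Ω.  Letters are Fin n;
-- the distinguished letter "1" of the paper is passed as an argument o.
Word : ℕ → Set
Word n = List (Fin n)

-- Finitely supported vectors of the Fock space, as formal sums
-- Σ c·w with rational coefficients (all vectors in the statement are such).
FVec : ℕ → Set
FVec n = List (ℚ × Word n)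

module _ {n : ℕ} where

  _≟w_ : (u v : Word n) → Relation.Nullary.Dec (u ≡ v)
  _≟w_ = LP.≡-dec Fin._≟_

  Ω : FVec n
  Ω = (1ℚ , []) ∷ []

  _⊕_ : FVec n → FVec n → FVec n
  _⊕_ = _++_

  scale : ℚ → FVec n → FVec n
  scale c = map (λ p → (c *ℚ proj₁ p , proj₂ p))

  _⊖_ : FVec n → FVec n → FVec n
  x ⊖ y = x ⊕ scale (- 1ℚ) y

  coeff : FVec n → Word n → ℚ
  coeff [] w = 0ℚ
  coeff ((c , u) ∷ x) w with u ≟w w
  ... | yes _ = c +ℚ coeff x w
  ... | no  _ = coeff x w

  _≈F_ : FVec n → FVec n → Set
  x ≈F y = ∀ w → coeff x w ≡ coeff y w

  -- inner product (real coefficients, so no conjugation is visible)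
  inner : FVec n → FVec n → ℚ
  inner [] y = 0ℚ
  inner ((c , u) ∷ x) y = c *ℚ coeff y u +ℚ inner x y

  cre : Fin n → FVec n → FVec n
  cre i = map (λ p → (proj₁ p , i ∷ proj₂ p))

  ann : Fin n → FVec n → FVec n
  ann i = concatMap f
    where
    f : ℚ × Word n → FVec n
    f (c , []) = []
    f (c , j ∷ w) with i Fin.≟ j
    ... | yes _ = (c , w) ∷ []
    ... | no  _ = []

  A : Fin n → FVec n → FVec n
  A i v = cre i v ⊕ ann i v

  -- Chebyshev polynomial P_k applied to an operator X
  P : ℕ → (FVec n → FVec n) → FVec n → FVec n
  P zero X v = v
  P (suc zero) X v = X v
  P (suc (suc k)) X v = X (P (suc k) X v) ⊖ P k X v

  -- S = P_{j1}(A_{i1}) ⋯ P_{jr}(A_{ir}) for the list ((i1,j1) ∷ … ∷ (ir,jr))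
  applyS : List (Fin n × ℕ) → FVec n → FVec n
  applyS [] v = v
  applyS ((i , j) ∷ s) v = P j (A i) (applyS s v)

  Alternating : List (Fin n × ℕ) → Set
  Alternating [] = Data.Unit.⊤ where import Data.Unit
  Alternating (_ ∷ []) = Data.Unit.⊤ where import Data.Unit
  Alternating (p ∷ q ∷ s) = (proj₁ p ≢ proj₁ q) × Alternating (q ∷ s)

  AllPos : List (Fin n × ℕ) → Set
  AllPos [] = Data.Unit.⊤ where import Data.Unit
  AllPos (p ∷ s) = (1 ≤ proj₂ p) × AllPos s

  lastOf : Fin n × ℕ → List (Fin n × ℕ) → Fin n × ℕ
  lastOf p [] = p
  lastOf p (q ∷ s) = lastOf q s

  module _ (o : Fin n) (s : List (Fin n × ℕ)) where

    Sop : ℕ → ℕ → FVec n → FVec n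
    Sop a b v = P a (A o) (applyS s (P b (A o) v))

    vv : ℕ → ℕ → FVec n
    vv a b = Sop a b (A o Ω) ⊖ A o (Sop a b Ω)

    -- √2 · w_{a,b} = v_{a,b} − v_{b,a}
    u : ℕ → ℕ → FVec n
    u a b = vv a b ⊖ vv b a

    Adm : ℕ → ℕ → ℕ → Set
    Adm m a b = (a < b) × ((a ℕ.+ b) % 2 ≡ 1) × (a ℕ.+ b ≤ 2 ℕ.* m ∸ 1)

    sumK : (ℕ → FVec n) → ℕ → FVec n
    sumK f zero = []
    sumK f (suc k) = sumK f k ⊕ f k

    combo : ℕ → (ℕ → ℕ → ℚ) → FVec n
    combo m c = sumK (λ a → sumK (λ b → scale (c a b) (u a b)) (2 ℕ.* m)) (2 ℕ.* m)

    InW : ℕ → FVec n → Set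
    InW m x = ∃ λ (c : ℕ → ℕ → ℚ) →
      (∀ a b → ¬ Adm m a b → c a b ≡ 0ℚ) × (x ≈F combo m c)

    PerpW : ℕ → FVec n → Set
    PerpW m x = ∀ a b → Adm m a b → inner x (u a b) ≡ 0ℚ

    IsOrthProj : ℕ → FVec n → FVec n → Set
    IsOrthProj m x p = InW m p × PerpW m (x ⊖ p)

    sm : ℕ → FVec n
    sm m = scale (+ 1 / suc (suc (suc (2 ℕ.* m))))
             (sumK (λ k → scale (+ (m ∸ k) / 1) (vv k (suc k) ⊖ vv (suc k) k)) m)

    SΩ : FVec n
    SΩ = applyS s Ω

-- S_{a,b}Ω is the single basis tensor e₁^{⊗a} ⊗ SΩ ⊗ e₁^{⊗b} (this is where i₁ ≠ 1 ≠ i_r is used), and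
-- these tensors are orthonormal, so everything reduces to coefficient arrays on the grid ℕ × ℕ.
-- By the recurrence A₁ P_k(A₁) = P_{k+1}(A₁) + P_{k−1}(A₁), v_{a,b} has coordinates
-- e_{a,b+1} + e_{a,b−1} − e_{a+1,b} − e_{a−1,b}.  Summing the weights m − k by parts and telescoping,
-- (2m + 3)(SΩ − s_m) has coordinate 3 at (0,0), 2 at (j,j) for 1 ≤ j ≤ m, −1 at (k,k+2) and (k+2,k)
-- for k < m, and 0 elsewhere.  This array is symmetric and its discrete commutator vanishes at every
-- admissible (a,b), which is the orthogonality to W^{2m−1}_S; and s_m lies in W^{2m−1}_S because it
-- is a combination of the w_{k,k+1} with k < m.

module Submission where

open import Defs
open import Data.Nat using (ℕ; _≤_; s≤s; z≤n)
open import Data.Nat.Properties using (≤-trans)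
open import Data.Fin using (Fin; fromℕ<)
open import Data.Product using (_×_; proj₁)
open import Data.List using (List; _∷_)
open import Relation.Binary.PropositionalEquality using (_≢_)

open import Data.Nat as ℕ using (zero; suc; _<_; _∸_; _%_)
import Data.Nat.Properties as ℕₚ
open import Data.Nat.DivMod using ([m+n]%n≡m%n; [m+kn]%n≡m%n)
open import Data.Nat.Tactic.RingSolver using (solve-∀)
import Data.Fin as Fin
import Data.Integer as ℤ
import Data.Integer.Properties as ℤₚ
open import Data.Rational using (ℚ; 0ℚ; 1ℚ; _+_; _*_; -_; _-_; _/_; toℚᵘ)
open import Data.Rational.Unnormalised as ℚᵘ using (mkℚᵘ; *≡*)
import Data.Rational.Unnormalised.Properties as ℚᵘₚ
import Data.Rational.Properties as ℚₚ
open import Data.Rational.Solver using (module +-*-Solver)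
open +-*-Solver using (solve; _:+_; _:*_; _:-_; :-_; _:=_; con)
open import Data.List using ([]; _++_; replicate; length)
import Data.List.Properties as Listₚ
open import Data.Product using (_,_; proj₂; ∃)
open import Data.Sum using (_⊎_; inj₁; inj₂)
open import Data.Empty using (⊥-elim)
open import Data.Bool using (true; false; if_then_else_)
open import Data.Unit using (⊤)
open import Relation.Nullary using (¬_; yes; no)
open import Relation.Binary using (Setoid)
open import Function using (_∘_)
open import Algebra.Bundles using (CommutativeMonoid)
open import Algebra.Properties.CommutativeSemigroup
  (CommutativeMonoid.commutativeSemigroup ℚₚ.+-0-commutativeMonoid) using () renaming (interchange to +-interchange)
open import Relation.Binary.PropositionalEquality
  using (_≡_; refl; sym; trans; cong; cong₂; subst; module ≡-Reasoning)

-- f (k − 1), reading f (−1) as z; with z = 0 this is the paper's convention P₋₁ = 0.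
at-pred : {A : Set} → A → (ℕ → A) → ℕ → A
at-pred z f zero    = z
at-pred z f (suc k) = f k

-- Coefficients of finitely supported vectors

module _ {n : ℕ} where

  single : Word n → FVec n
  single w = (1ℚ , w) ∷ []

  coeff-∷-≡ : ∀ c {u w : Word n} x → u ≡ w → coeff ((c , u) ∷ x) w ≡ c + coeff x w
  coeff-∷-≡ c {u} {w} x u≡w with u ≟w w
  ... | yes _  = refl
  ... | no u≢w = ⊥-elim (u≢w u≡w)

  coeff-∷-≢ : ∀ c {u w : Word n} x → u ≢ w → coeff ((c , u) ∷ x) w ≡ coeff x w
  coeff-∷-≢ c {u} {w} x u≢w with u ≟w w
  ... | yes u≡w = ⊥-elim (u≢w u≡w)
  ... | no _    = refl

  coeff-⊕ : ∀ (x y : FVec n) w → coeff (x ⊕ y) w ≡ coeff x w + coeff y w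
  coeff-⊕ []            y w = sym (ℚₚ.+-identityˡ _)
  coeff-⊕ ((c , u) ∷ x) y w with u ≟w w
  ... | yes _ = trans (cong (c +_) (coeff-⊕ x y w)) (sym (ℚₚ.+-assoc c _ _))
  ... | no _  = coeff-⊕ x y w

  coeff-scale : ∀ c (x : FVec n) w → coeff (scale c x) w ≡ c * coeff x w
  coeff-scale c []            w = sym (ℚₚ.*-zeroʳ c)
  coeff-scale c ((d , u) ∷ x) w with u ≟w w
  ... | yes _ = trans (cong (c * d +_) (coeff-scale c x w)) (sym (ℚₚ.*-distribˡ-+ c d _))
  ... | no _  = coeff-scale c x w

  coeff-⊖ : ∀ (x y : FVec n) w → coeff (x ⊖ y) w ≡ coeff x w - coeff y w
  coeff-⊖ x y w = begin
    coeff (x ⊕ scale (- 1ℚ) y) w          ≡⟨ coeff-⊕ x _ w ⟩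
    coeff x w + coeff (scale (- 1ℚ) y) w  ≡⟨ cong (coeff x w +_) (coeff-scale (- 1ℚ) y w) ⟩
    coeff x w + - 1ℚ * coeff y w          ≡⟨ solve 2 (λ a b → a :+ con (- 1ℚ) :* b := a :- b) refl (coeff x w) (coeff y w) ⟩
    coeff x w - coeff y w                 ∎
    where open ≡-Reasoning

  coeff-single : ∀ (w : Word n) → coeff (single w) w ≡ 1ℚ
  coeff-single w = trans (coeff-∷-≡ 1ℚ {w} [] refl) (ℚₚ.+-identityʳ 1ℚ)

  coeff-single-≢ : ∀ {u w : Word n} → u ≢ w → coeff (single u) w ≡ 0ℚ
  coeff-single-≢ u≢w = coeff-∷-≢ 1ℚ [] u≢w

  coeff-∷-cong : ∀ c {u w u′ w′ : Word n} x x′ → (u ≡ w → u′ ≡ w′) → (u′ ≡ w′ → u ≡ w) →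
                 coeff x w ≡ coeff x′ w′ → coeff ((c , u) ∷ x) w ≡ coeff ((c , u′) ∷ x′) w′
  coeff-∷-cong c {u} {w} {u′} {w′} x x′ to from eq with u ≟w w | u′ ≟w w′
  ... | yes _   | yes _    = cong (c +_) eq
  ... | no _    | no _     = eq
  ... | yes u≡w | no u′≢w′ = ⊥-elim (u′≢w′ (to u≡w))
  ... | no u≢w  | yes u′≡w′ = ⊥-elim (u≢w (from u′≡w′))

  ∷-injective : ∀ {i j : Fin n} {u w : Word n} → _≡_ {A = Word n} (i ∷ u) (j ∷ w) → i ≡ j × u ≡ w
  ∷-injective refl = refl , refl

  coeff-cre-[] : ∀ i (x : FVec n) → coeff (cre i x) [] ≡ 0ℚ
  coeff-cre-[] i []            = refl
  coeff-cre-[] i ((c , u) ∷ x) = trans (coeff-∷-≢ c {i ∷ u} (cre i x) (λ ())) (coeff-cre-[] i x)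

  coeff-cre-∷ : ∀ i (x : FVec n) w → coeff (cre i x) (i ∷ w) ≡ coeff x w
  coeff-cre-∷ i []            w = refl
  coeff-cre-∷ i ((c , u) ∷ x) w =
    coeff-∷-cong c _ x (proj₂ ∘ ∷-injective) (cong (i ∷_)) (coeff-cre-∷ i x w)

  coeff-cre-≢ : ∀ {i j} (x : FVec n) w → i ≢ j → coeff (cre i x) (j ∷ w) ≡ 0ℚ
  coeff-cre-≢ []            w i≢j = refl
  coeff-cre-≢ ((c , u) ∷ x) w i≢j =
    trans (coeff-∷-≢ c _ (λ e → i≢j (proj₁ (∷-injective e)))) (coeff-cre-≢ x w i≢j)

  coeff-ann : ∀ i (x : FVec n) w → coeff (ann i x) w ≡ coeff x (i ∷ w)
  coeff-ann i []                w = refl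
  coeff-ann i ((c , [])    ∷ x) w = trans (coeff-ann i x w) (sym (coeff-∷-≢ c {[]} x (λ ())))
  coeff-ann i ((c , j ∷ v) ∷ x) w with i Fin.≟ j
  ... | no i≢j  = trans (coeff-ann i x w) (sym (coeff-∷-≢ c x (λ e → i≢j (sym (proj₁ (∷-injective e))))))
  ... | yes refl =
    coeff-∷-cong c (ann i x) x (cong (i ∷_)) (proj₂ ∘ ∷-injective) (coeff-ann i x w)

  -- A record rather than Defs' _≈F_, so that both sides can be inferred.
  record _≋_ (x y : FVec n) : Set where
    constructor coeffwise
    field coeff-≡ : ∀ w → coeff x w ≡ coeff y w
  open _≋_ public
  infix 4 _≋_

  ≋-setoid : Setoid _ _
  ≋-setoid = record
    { Carrier       = FVec n
    ; _≈_           = _≋_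
    ; isEquivalence = record
      { refl  = coeffwise (λ _ → refl)
      ; sym   = λ x≋y → coeffwise (λ w → sym (coeff-≡ x≋y w))
      ; trans = λ x≋y y≋z → coeffwise (λ w → trans (coeff-≡ x≋y w) (coeff-≡ y≋z w))
      }
    }

  open Setoid ≋-setoid public using () renaming (refl to ≋-refl; sym to ≋-sym; trans to ≋-trans)

  ≡⇒≋ : {x y : FVec n} → x ≡ y → x ≋ y
  ≡⇒≋ refl = ≋-refl

  ⊕-cong : {x x′ y y′ : FVec n} → x ≋ x′ → y ≋ y′ → x ⊕ y ≋ x′ ⊕ y′
  ⊕-cong {x} {x′} {y} {y′} x≋x′ y≋y′ = coeffwise λ w →
    trans (coeff-⊕ x y w) (trans (cong₂ _+_ (coeff-≡ x≋x′ w) (coeff-≡ y≋y′ w)) (sym (coeff-⊕ x′ y′ w)))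

  ⊖-cong : {x x′ y y′ : FVec n} → x ≋ x′ → y ≋ y′ → x ⊖ y ≋ x′ ⊖ y′
  ⊖-cong {x} {x′} {y} {y′} x≋x′ y≋y′ = coeffwise λ w →
    trans (coeff-⊖ x y w) (trans (cong₂ _-_ (coeff-≡ x≋x′ w) (coeff-≡ y≋y′ w)) (sym (coeff-⊖ x′ y′ w)))

  scale-cong : ∀ c {x y : FVec n} → x ≋ y → scale c x ≋ scale c y
  scale-cong c {x} {y} x≋y = coeffwise λ w →
    trans (coeff-scale c x w) (trans (cong (c *_) (coeff-≡ x≋y w)) (sym (coeff-scale c y w)))

  ⊕-interchange : ∀ (x y z t : FVec n) → (x ⊕ y) ⊕ (z ⊕ t) ≋ (x ⊕ z) ⊕ (y ⊕ t)
  ⊕-interchange x y z t = coeffwise λ w → begin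
    coeff ((x ⊕ y) ⊕ (z ⊕ t)) w                         ≡⟨ coeff-⊕ (x ⊕ y) _ w ⟩
    coeff (x ⊕ y) w + coeff (z ⊕ t) w                   ≡⟨ cong₂ _+_ (coeff-⊕ x y w) (coeff-⊕ z t w) ⟩
    (coeff x w + coeff y w) + (coeff z w + coeff t w)   ≡⟨ +-interchange (coeff x w) (coeff y w) (coeff z w) (coeff t w) ⟩
    (coeff x w + coeff z w) + (coeff y w + coeff t w)   ≡⟨ sym (cong₂ _+_ (coeff-⊕ x z w) (coeff-⊕ y t w)) ⟩
    coeff (x ⊕ z) w + coeff (y ⊕ t) w                   ≡⟨ sym (coeff-⊕ (x ⊕ z) _ w) ⟩
    coeff ((x ⊕ z) ⊕ (y ⊕ t)) w                         ∎
    where open ≡-Reasoning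

  inner-⊕ʳ : ∀ (x y z : FVec n) → inner x (y ⊕ z) ≡ inner x y + inner x z
  inner-⊕ʳ []            y z = sym (ℚₚ.+-identityˡ 0ℚ)
  inner-⊕ʳ ((c , u) ∷ x) y z = begin
    c * coeff (y ⊕ z) u + inner x (y ⊕ z)
      ≡⟨ cong₂ _+_ (cong (c *_) (coeff-⊕ y z u)) (inner-⊕ʳ x y z) ⟩
    c * (coeff y u + coeff z u) + (inner x y + inner x z)
      ≡⟨ solve 5 (λ c a b p q → c :* (a :+ b) :+ (p :+ q) := (c :* a :+ p) :+ (c :* b :+ q)) refl
                 c (coeff y u) (coeff z u) (inner x y) (inner x z) ⟩
    (c * coeff y u + inner x y) + (c * coeff z u + inner x z) ∎
    where open ≡-Reasoning

  inner-⊖ʳ : ∀ (x y z : FVec n) → inner x (y ⊖ z) ≡ inner x y - inner x z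
  inner-⊖ʳ []            y z = refl
  inner-⊖ʳ ((c , u) ∷ x) y z = begin
    c * coeff (y ⊖ z) u + inner x (y ⊖ z)
      ≡⟨ cong₂ _+_ (cong (c *_) (coeff-⊖ y z u)) (inner-⊖ʳ x y z) ⟩
    c * (coeff y u - coeff z u) + (inner x y - inner x z)
      ≡⟨ solve 5 (λ c a b p q → c :* (a :- b) :+ (p :- q) := (c :* a :+ p) :- (c :* b :+ q)) refl
                 c (coeff y u) (coeff z u) (inner x y) (inner x z) ⟩
    (c * coeff y u + inner x y) - (c * coeff z u + inner x z) ∎
    where open ≡-Reasoning

  inner-[]ʳ : ∀ (x : FVec n) → inner x [] ≡ 0ℚ
  inner-[]ʳ []            = refl
  inner-[]ʳ ((c , u) ∷ x) = trans (cong₂ _+_ (ℚₚ.*-zeroʳ c) (inner-[]ʳ x)) (ℚₚ.+-identityˡ 0ℚ)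

  inner-respʳ : ∀ (x : FVec n) {y z} → y ≋ z → inner x y ≡ inner x z
  inner-respʳ []            y≋z = refl
  inner-respʳ ((c , u) ∷ x) y≋z = cong₂ _+_ (cong (c *_) (coeff-≡ y≋z u)) (inner-respʳ x y≋z)

  inner-singleʳ : ∀ (x : FVec n) w → inner x (single w) ≡ coeff x w
  inner-singleʳ []            w = refl
  inner-singleʳ ((c , u) ∷ x) w with u ≟w w
  ... | yes refl = cong₂ _+_ (trans (cong (c *_) (coeff-single u)) (ℚₚ.*-identityʳ c)) (inner-singleʳ x u)
  ... | no u≢w   = trans (cong₂ _+_ (trans (cong (c *_) (coeff-single-≢ (u≢w ∘ sym))) (ℚₚ.*-zeroʳ c))
                                   (inner-singleʳ x w))
                         (ℚₚ.+-identityˡ (coeff x w))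

  -- Linear operators

  record IsLinear (X : FVec n → FVec n) : Set where
    field
      resp-≋     : ∀ {x y} → x ≋ y → X x ≋ X y
      ⊕-homo     : ∀ x y → X (x ⊕ y) ≋ X x ⊕ X y
      scale-homo : ∀ c x → X (scale c x) ≋ scale c (X x)

    []-homo : X [] ≋ []
    []-homo = coeffwise λ w → begin
      coeff (X (scale 0ℚ [])) w   ≡⟨ coeff-≡ (scale-homo 0ℚ []) w ⟩
      coeff (scale 0ℚ (X [])) w   ≡⟨ coeff-scale 0ℚ (X []) w ⟩
      0ℚ * coeff (X []) w         ≡⟨ ℚₚ.*-zeroˡ (coeff (X []) w) ⟩
      0ℚ                          ∎
      where open ≡-Reasoning

    ⊖-homo : ∀ x y → X (x ⊖ y) ≋ X x ⊖ X y
    ⊖-homo x y = ≋-trans (⊕-homo x _) (⊕-cong ≋-refl (scale-homo (- 1ℚ) y))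

  open IsLinear public

  IsReindexing : (FVec n → FVec n) → Set
  IsReindexing X = ∀ w → (∀ x → coeff (X x) w ≡ 0ℚ) ⊎ ∃ λ w′ → ∀ x → coeff (X x) w ≡ coeff x w′

  reindexing⇒linear : ∀ {X} → IsReindexing X → IsLinear X
  reindexing⇒linear {X} R = record
    { resp-≋     = λ x≋y → coeffwise (resp x≋y)
    ; ⊕-homo     = λ x y → coeffwise λ w → trans (additive x y w) (sym (coeff-⊕ (X x) (X y) w))
    ; scale-homo = λ c x → coeffwise λ w → trans (homogeneous c x w) (sym (coeff-scale c (X x) w))
    }
    where
    resp : ∀ {x y} → x ≋ y → ∀ w → coeff (X x) w ≡ coeff (X y) w
    resp {x} {y} x≋y w with R w
    ... | inj₁ kill       = trans (kill x) (sym (kill y))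
    ... | inj₂ (w′ , copy) = trans (copy x) (trans (coeff-≡ x≋y w′) (sym (copy y)))

    additive : ∀ x y w → coeff (X (x ⊕ y)) w ≡ coeff (X x) w + coeff (X y) w
    additive x y w with R w
    ... | inj₁ kill       = trans (kill _) (sym (trans (cong₂ _+_ (kill x) (kill y)) (ℚₚ.+-identityˡ 0ℚ)))
    ... | inj₂ (w′ , copy) = trans (copy _) (trans (coeff-⊕ x y w′) (sym (cong₂ _+_ (copy x) (copy y))))

    homogeneous : ∀ c x w → coeff (X (scale c x)) w ≡ c * coeff (X x) w
    homogeneous c x w with R w
    ... | inj₁ kill       = trans (kill _) (sym (trans (cong (c *_) (kill x)) (ℚₚ.*-zeroʳ c)))
    ... | inj₂ (w′ , copy) = trans (copy _) (trans (coeff-scale c x w′) (cong (c *_) (sym (copy x))))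

  cre-reindexing : ∀ i → IsReindexing (cre i)
  cre-reindexing i []      = inj₁ (coeff-cre-[] i)
  cre-reindexing i (j ∷ w) with i Fin.≟ j
  ... | yes refl = inj₂ (w , λ x → coeff-cre-∷ i x w)
  ... | no i≢j   = inj₁ (λ x → coeff-cre-≢ x w i≢j)

  ann-reindexing : ∀ i → IsReindexing (ann i)
  ann-reindexing i w = inj₂ (i ∷ w , λ x → coeff-ann i x w)

  id-linear : IsLinear (λ v → v)
  id-linear = record { resp-≋ = λ e → e ; ⊕-homo = λ _ _ → ≋-refl ; scale-homo = λ _ _ → ≋-refl }

  ∘-linear : ∀ {X Y} → IsLinear X → IsLinear Y → IsLinear (λ v → X (Y v))
  ∘-linear {X} {Y} LX LY = record
    { resp-≋     = λ e → resp-≋ LX (resp-≋ LY e)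
    ; ⊕-homo     = λ x y → ≋-trans (resp-≋ LX (⊕-homo LY x y)) (⊕-homo LX (Y x) (Y y))
    ; scale-homo = λ c x → ≋-trans (resp-≋ LX (scale-homo LY c x)) (scale-homo LX c (Y x))
    }

  scale-⊕ : ∀ c (x y : FVec n) → scale c (x ⊕ y) ≡ scale c x ⊕ scale c y
  scale-⊕ c = Listₚ.map-++ _

  ⊕-linear : ∀ {X Y} → IsLinear X → IsLinear Y → IsLinear (λ v → X v ⊕ Y v)
  ⊕-linear {X} {Y} LX LY = record
    { resp-≋     = λ e → ⊕-cong (resp-≋ LX e) (resp-≋ LY e)
    ; ⊕-homo     = λ x y → ≋-trans (⊕-cong (⊕-homo LX x y) (⊕-homo LY x y)) (⊕-interchange (X x) (X y) (Y x) (Y y))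
    ; scale-homo = λ c x → ≋-trans (⊕-cong (scale-homo LX c x) (scale-homo LY c x))
                                   (≡⇒≋ (sym (scale-⊕ c (X x) (Y x))))
    }

  scale-linear : ∀ c → IsLinear (scale c)
  scale-linear c = record
    { resp-≋     = scale-cong c
    ; ⊕-homo     = λ x y → ≡⇒≋ (scale-⊕ c x y)
    ; scale-homo = λ d x → coeffwise λ w → begin
        coeff (scale c (scale d x)) w   ≡⟨ trans (coeff-scale c (scale d x) w) (cong (c *_) (coeff-scale d x w)) ⟩
        c * (d * coeff x w)             ≡⟨ solve 3 (λ c d a → c :* (d :* a) := d :* (c :* a)) refl c d (coeff x w) ⟩
        d * (c * coeff x w)             ≡⟨ sym (trans (coeff-scale d (scale c x) w) (cong (d *_) (coeff-scale c x w))) ⟩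
        coeff (scale d (scale c x)) w   ∎
    }
    where open ≡-Reasoning

  ⊖-linear : ∀ {X Y} → IsLinear X → IsLinear Y → IsLinear (λ v → X v ⊖ Y v)
  ⊖-linear LX LY = ⊕-linear LX (∘-linear (scale-linear (- 1ℚ)) LY)

  A-linear : ∀ i → IsLinear (A i)
  A-linear i = ⊕-linear {cre i} {ann i} (reindexing⇒linear (cre-reindexing i)) (reindexing⇒linear (ann-reindexing i))

  P-linear : ∀ k {X} → IsLinear X → IsLinear (P k X)
  P-linear zero          LX = id-linear
  P-linear (suc zero)    LX = LX
  P-linear (suc (suc k)) LX = ⊖-linear (∘-linear LX (P-linear (suc k) LX)) (P-linear k LX)

  applyS-linear : ∀ s → IsLinear (applyS s)
  applyS-linear []            = id-linear
  applyS-linear ((i , j) ∷ s) = ∘-linear (P-linear j (A-linear i)) (applyS-linear s)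

  at-pred-cong : ∀ {f g : ℕ → FVec n} k → (∀ j → f j ≋ g j) → at-pred [] f k ≋ at-pred [] g k
  at-pred-cong zero    _   = ≋-refl
  at-pred-cong (suc k) f≋g = f≋g k

  at-pred-linear : ∀ {X} → IsLinear X → ∀ (f : ℕ → FVec n) k → X (at-pred [] f k) ≋ at-pred [] (X ∘ f) k
  at-pred-linear LX f zero    = []-homo LX
  at-pred-linear LX f (suc k) = ≋-refl

  ⊕-⊖-cancel : ∀ (x y : FVec n) → (x ⊕ y) ⊖ y ≋ x
  ⊕-⊖-cancel x y = coeffwise λ w → begin
    coeff ((x ⊕ y) ⊖ y) w             ≡⟨ trans (coeff-⊖ (x ⊕ y) y w) (cong (_- coeff y w) (coeff-⊕ x y w)) ⟩
    coeff x w + coeff y w - coeff y w ≡⟨ solve 2 (λ a b → a :+ b :- b := a) refl (coeff x w) (coeff y w) ⟩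
    coeff x w                         ∎
    where open ≡-Reasoning

  ⊖-⊕-cancel : ∀ (x y : FVec n) → (x ⊖ y) ⊕ y ≋ x
  ⊖-⊕-cancel x y = coeffwise λ w → begin
    coeff ((x ⊖ y) ⊕ y) w             ≡⟨ trans (coeff-⊕ (x ⊖ y) y w) (cong (_+ coeff y w) (coeff-⊖ x y w)) ⟩
    coeff x w - coeff y w + coeff y w ≡⟨ solve 2 (λ a b → a :- b :+ b := a) refl (coeff x w) (coeff y w) ⟩
    coeff x w                         ∎
    where open ≡-Reasoning

  module _ {X : FVec n → FVec n} (LX : IsLinear X) where

    P-recurrence : ∀ k v → X (P k X v) ≋ P (suc k) X v ⊕ at-pred [] (λ j → P j X v) k
    P-recurrence zero    v = ≡⇒≋ (sym (Listₚ.++-identityʳ (X v)))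
    P-recurrence (suc k) v = ≋-sym (⊖-⊕-cancel (X (P (suc k) X v)) (P k X v))

    P-comm : ∀ k v → P k X (X v) ≋ X (P k X v)
    P-comm zero          v = ≋-refl
    P-comm (suc zero)    v = ≋-refl
    P-comm (suc (suc k)) v = ≋-trans (⊖-cong (resp-≋ LX (P-comm (suc k) v)) (P-comm k v))
                                     (≋-sym (⊖-homo LX (X (P (suc k) X v)) (P k X v)))

  -- Words

  NotHeadedBy : Fin n → Word n → Set
  NotHeadedBy o []      = ⊤
  NotHeadedBy o (j ∷ _) = j ≢ o

  A-single-fresh : ∀ o {w} → NotHeadedBy o w → A o (single w) ≋ single (o ∷ w)
  A-single-fresh o {[]}    _   = ≋-refl
  A-single-fresh o {j ∷ v} j≢o with o Fin.≟ j
  ... | yes o≡j = ⊥-elim (j≢o (sym o≡j))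
  ... | no _    = ≋-refl

  A-single-headed : ∀ o (v : Word n) → A o (single (o ∷ v)) ≋ single (o ∷ o ∷ v) ⊕ single v
  A-single-headed o v with o Fin.≟ o
  ... | yes _  = ≋-refl
  ... | no o≢o = ⊥-elim (o≢o refl)

  P-single : ∀ o k {w} → NotHeadedBy o w → P k (A o) (single w) ≋ single (replicate k o ++ w)
  P-single o zero          fresh = ≋-refl
  P-single o (suc zero)    fresh = A-single-fresh o fresh
  P-single o (suc (suc k)) {w} fresh = begin
    A o (P (suc k) (A o) (single w)) ⊖ P k (A o) (single w)
      ≈⟨ ⊖-cong (resp-≋ (A-linear o) (P-single o (suc k) fresh)) (P-single o k fresh) ⟩
    A o (single (o ∷ r)) ⊖ single r
      ≈⟨ ⊖-cong (A-single-headed o r) (≋-refl {single r}) ⟩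
    (single (o ∷ o ∷ r) ⊕ single r) ⊖ single r
      ≈⟨ ⊕-⊖-cancel (single (o ∷ o ∷ r)) (single r) ⟩
    single (o ∷ o ∷ r) ∎
    where
    r = replicate k o ++ w
    open import Relation.Binary.Reasoning.Setoid ≋-setoid

  blocks : List (Fin n × ℕ) → Word n → Word n
  blocks []            w = w
  blocks ((i , j) ∷ s) w = replicate j i ++ blocks s w

  blocks-not-headed : ∀ {o i j} s w → 1 ≤ j → i ≢ o → NotHeadedBy o (blocks ((i , j) ∷ s) w)
  blocks-not-headed {j = suc _} s w _ i≢o = i≢o

  applyS-single : ∀ p ps {w} → AllPos (p ∷ ps) → Alternating (p ∷ ps) →
                  NotHeadedBy (proj₁ (lastOf p ps)) w → applyS (p ∷ ps) (single w) ≋ single (blocks (p ∷ ps) w)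
  applyS-single (i , j) []               _             _            fresh = P-single i j fresh
  applyS-single (i , j) ((i′ , j′) ∷ qs) (_ , pos , ps) (i≢i′ , alt) fresh =
    ≋-trans (resp-≋ (P-linear j (A-linear i)) (applyS-single (i′ , j′) qs (pos , ps) alt fresh))
            (P-single i j (blocks-not-headed qs _ pos (i≢i′ ∘ sym)))

  replicate-prefix-injective : ∀ o a a′ {Z Z′ : Word n} → NotHeadedBy o Z → NotHeadedBy o Z′ →
                               replicate a o ++ Z ≡ replicate a′ o ++ Z′ → a ≡ a′ × Z ≡ Z′
  replicate-prefix-injective o zero    zero     _  _   e = refl , e
  replicate-prefix-injective o zero    (suc a′) {j ∷ Z} fresh _ e = ⊥-elim (fresh (proj₁ (∷-injective e)))
  replicate-prefix-injective o (suc a) zero     {Z′ = j ∷ Z′} _ fresh e = ⊥-elim (fresh (sym (proj₁ (∷-injective e))))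
  replicate-prefix-injective o (suc a) (suc a′) fresh fresh′ e
    with replicate-prefix-injective o a a′ fresh fresh′ (proj₂ (∷-injective e))
  ... | refl , Z≡Z′ = refl , Z≡Z′

  replicate-injective : ∀ (o : Fin n) {b b′} → replicate b o ≡ replicate b′ o → b ≡ b′
  replicate-injective o {b} {b′} e =
    trans (sym (Listₚ.length-replicate b)) (trans (cong length e) (Listₚ.length-replicate b′))

  blocks-cancel : ∀ s {w w′ : Word n} → blocks s w ≡ blocks s w′ → w ≡ w′
  blocks-cancel []            e = e
  blocks-cancel ((i , j) ∷ s) e = blocks-cancel s (Listₚ.++-cancelˡ (replicate j i) _ _ e)


-- Rational sums

ι : ℕ → ℚ
ι k = ℤ.+ k / 1

-- Identities for ι are checked in ℚᵘ, where + k / 1 is literally mkℚᵘ (+ k) 0.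
private
  ι-toℚᵘ : ∀ k → toℚᵘ (ι k) ℚᵘ.≃ mkℚᵘ (ℤ.+ k) 0
  ι-toℚᵘ k = ℚₚ.toℚᵘ-fromℚᵘ (mkℚᵘ (ℤ.+ k) 0)

ι-suc : ∀ k → ι (suc k) ≡ 1ℚ + ι k
ι-suc k = ℚₚ.toℚᵘ-injective (ℚᵘₚ.≃-sym (ℚᵘₚ.≃-trans (ℚₚ.toℚᵘ-homo-+ 1ℚ (ι k))
  (ℚᵘₚ.≃-trans (ℚᵘₚ.+-congʳ (toℚᵘ 1ℚ) (ι-toℚᵘ k)) (ℚᵘₚ.≃-trans (*≡* eq) (ℚᵘₚ.≃-sym (ι-toℚᵘ (suc k)))))))
  where
  eq : (ℤ.1ℤ ℤ.* ℤ.1ℤ ℤ.+ ℤ.+ k ℤ.* ℤ.1ℤ) ℤ.* ℤ.1ℤ ≡ ℤ.+ suc k ℤ.* (ℤ.1ℤ ℤ.* ℤ.1ℤ)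
  eq = trans (ℤₚ.*-identityʳ _) (trans (cong (ℤ._+_ ℤ.1ℤ) (ℤₚ.*-identityʳ (ℤ.+ k))) (sym (ℤₚ.*-identityʳ (ℤ.+ suc k))))

ι-+ : ∀ j k → ι (j ℕ.+ k) ≡ ι j + ι k
ι-+ zero    k = sym (ℚₚ.+-identityˡ (ι k))
ι-+ (suc j) k = begin
  ι (suc (j ℕ.+ k))   ≡⟨ ι-suc (j ℕ.+ k) ⟩
  1ℚ + ι (j ℕ.+ k)    ≡⟨ cong (1ℚ +_) (ι-+ j k) ⟩
  1ℚ + (ι j + ι k)    ≡⟨ sym (ℚₚ.+-assoc 1ℚ (ι j) (ι k)) ⟩
  (1ℚ + ι j) + ι k    ≡⟨ cong (_+ ι k) (sym (ι-suc j)) ⟩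
  ι (suc j) + ι k     ∎
  where open ≡-Reasoning

ι-inverse : ∀ k → (ℤ.+ 1 / suc k) * ι (suc k) ≡ 1ℚ
ι-inverse k = ℚₚ.toℚᵘ-injective (ℚᵘₚ.≃-trans (ℚₚ.toℚᵘ-homo-* (ℤ.+ 1 / suc k) (ι (suc k)))
  (ℚᵘₚ.≃-trans (ℚᵘₚ.*-cong (ℚₚ.toℚᵘ-fromℚᵘ (mkℚᵘ (ℤ.+ 1) k)) (ι-toℚᵘ (suc k))) (*≡* (ℤₚ.*-assoc (ℤ.+ 1) (ℤ.+ suc k) (ℤ.+ 1)))))

∑ : ℕ → (ℕ → ℚ) → ℚ
∑ zero    f = 0ℚ
∑ (suc m) f = ∑ m f + f m

∑-cong : ∀ m {f g} → (∀ k → k < m → f k ≡ g k) → ∑ m f ≡ ∑ m g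
∑-cong zero    _   = refl
∑-cong (suc m) f≡g = cong₂ _+_ (∑-cong m (λ k k<m → f≡g k (ℕₚ.m<n⇒m<1+n k<m))) (f≡g m ℕₚ.≤-refl)

∑-const : ∀ m c → ∑ m (λ _ → c) ≡ ι m * c
∑-const zero    c = sym (ℚₚ.*-zeroˡ c)
∑-const (suc m) c = begin
  ∑ m (λ _ → c) + c   ≡⟨ cong (_+ c) (∑-const m c) ⟩
  ι m * c + c         ≡⟨ solve 2 (λ i c → i :* c :+ c := (con 1ℚ :+ i) :* c) refl (ι m) c ⟩
  (1ℚ + ι m) * c      ≡⟨ cong (_* c) (sym (ι-suc m)) ⟩
  ι (suc m) * c       ∎
  where open ≡-Reasoning

∑-zero : ∀ m {f} → (∀ k → k < m → f k ≡ 0ℚ) → ∑ m f ≡ 0ℚ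
∑-zero m f≡0 = trans (∑-cong m f≡0) (trans (∑-const m 0ℚ) (ℚₚ.*-zeroʳ (ι m)))

∑-single : ∀ m {f} j → j < m → (∀ k → k < m → k ≢ j → f k ≡ 0ℚ) → ∑ m f ≡ f j
∑-single (suc m) {f} j j<1+m f≡0 with j ℕ.≟ m
... | yes refl = trans (cong (_+ f j) (∑-zero m (λ k k<m → f≡0 k (ℕₚ.m<n⇒m<1+n k<m) (ℕₚ.<⇒≢ k<m))))
                       (ℚₚ.+-identityˡ (f j))
... | no j≢m   = trans (cong₂ _+_ (∑-single m j (ℕₚ.≤∧≢⇒< (ℕₚ.≤-pred j<1+m) j≢m)
                                     (λ k k<m → f≡0 k (ℕₚ.m<n⇒m<1+n k<m)))
                                  (f≡0 m ℕₚ.≤-refl (j≢m ∘ sym)))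
                       (ℚₚ.+-identityʳ (f j))

∑-+ : ∀ m (f g : ℕ → ℚ) → ∑ m (λ k → f k + g k) ≡ ∑ m f + ∑ m g
∑-+ zero    f g = sym (ℚₚ.+-identityˡ 0ℚ)
∑-+ (suc m) f g = trans (cong (_+ (f m + g m)) (∑-+ m f g))
                        (+-interchange (∑ m f) (∑ m g) (f m) (g m))

∑-scale : ∀ m c (f : ℕ → ℚ) → ∑ m (λ k → c * f k) ≡ c * ∑ m f
∑-scale zero    c f = sym (ℚₚ.*-zeroʳ c)
∑-scale (suc m) c f = trans (cong (_+ c * f m) (∑-scale m c f)) (sym (ℚₚ.*-distribˡ-+ c (∑ m f) (f m)))

∑-truncate : ∀ m k {f} → (∀ j → m ≤ j → f j ≡ 0ℚ) → ∑ (k ℕ.+ m) f ≡ ∑ m f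
∑-truncate m zero    f≡0 = refl
∑-truncate m (suc k) f≡0 =
  trans (cong₂ _+_ (∑-truncate m k f≡0) (f≡0 (k ℕ.+ m) (ℕₚ.m≤n+m m k))) (ℚₚ.+-identityʳ _)

-- Abel summation.
∑-weighted : ∀ m f → ∑ m (λ k → ι (m ∸ k) * f k) ≡ ∑ m (λ j → ∑ (suc j) f)
∑-weighted zero    f = refl
∑-weighted (suc m) f = begin
  ∑ m (λ k → ι (suc m ∸ k) * f k) + ι (suc m ∸ m) * f m
    ≡⟨ cong₂ _+_ (∑-cong m one-more) last-weight ⟩
  ∑ m (λ k → ι (m ∸ k) * f k + f k) + f m
    ≡⟨ cong (_+ f m) (∑-+ m _ f) ⟩
  (∑ m (λ k → ι (m ∸ k) * f k) + ∑ m f) + f m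
    ≡⟨ ℚₚ.+-assoc (∑ m (λ k → ι (m ∸ k) * f k)) (∑ m f) (f m) ⟩
  ∑ m (λ k → ι (m ∸ k) * f k) + ∑ (suc m) f
    ≡⟨ cong (_+ ∑ (suc m) f) (∑-weighted m f) ⟩
  ∑ m (λ j → ∑ (suc j) f) + ∑ (suc m) f ∎
  where
  open ≡-Reasoning
  one-more : ∀ k → k < m → ι (suc m ∸ k) * f k ≡ ι (m ∸ k) * f k + f k
  one-more k k<m = begin
    ι (suc m ∸ k) * f k      ≡⟨ cong (λ i → ι i * f k) (ℕₚ.+-∸-assoc 1 (ℕₚ.<⇒≤ k<m)) ⟩
    ι (suc (m ∸ k)) * f k    ≡⟨ cong (_* f k) (ι-suc (m ∸ k)) ⟩
    (1ℚ + ι (m ∸ k)) * f k   ≡⟨ solve 2 (λ i a → (con 1ℚ :+ i) :* a := i :* a :+ a) refl (ι (m ∸ k)) (f k) ⟩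
    ι (m ∸ k) * f k + f k    ∎
  last-weight : ι (suc m ∸ m) * f m ≡ f m
  last-weight = trans (cong (λ i → ι i * f m) (trans (ℕₚ.+-∸-assoc 1 (ℕₚ.≤-refl {m})) (cong suc (ℕₚ.n∸n≡0 m))))
                      (ℚₚ.*-identityˡ (f m))

-- Grid functions

δ : ℕ → ℕ → ℚ
δ x y = if x ℕ.≡ᵇ y then 1ℚ else 0ℚ

δ-refl : ∀ x → δ x x ≡ 1ℚ
δ-refl zero    = refl
δ-refl (suc x) = δ-refl x

δ-≢ : ∀ {x y} → x ≢ y → δ x y ≡ 0ℚ
δ-≢ {zero}  {zero}  x≢y = ⊥-elim (x≢y refl)
δ-≢ {zero}  {suc y} _   = refl
δ-≢ {suc x} {zero}  _   = refl
δ-≢ {suc x} {suc y} x≢y = δ-≢ (x≢y ∘ cong suc)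

-- δ₂ x y p q is the coefficient of S_{p,q}Ω along S_{x,y}Ω (see coeff-basis).
δ₂ : ℕ → ℕ → ℕ → ℕ → ℚ
δ₂ x y p q = δ p x * δ q y

δ₂-diag : ∀ x y → δ₂ x y x y ≡ 1ℚ
δ₂-diag x y = cong₂ _*_ (δ-refl x) (δ-refl y)

δ₂-off : ∀ x y p q → (p ≡ x → q ≢ y) → δ₂ x y p q ≡ 0ℚ
δ₂-off x y p q h with p ℕ.≟ x
... | yes p≡x = trans (cong (δ p x *_) (δ-≢ (h p≡x))) (ℚₚ.*-zeroʳ (δ p x))
... | no p≢x  = trans (cong (_* δ q y) (δ-≢ p≢x)) (ℚₚ.*-zeroˡ (δ q y))

δ₂-swap : ∀ x y p q → δ₂ x y p q ≡ δ₂ y x q p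
δ₂-swap x y p q = ℚₚ.*-comm (δ p x) (δ q y)

-- Grid functions g x y are read as coordinates on the vectors S_{x,y}Ω.  Δ g a b is g applied
-- to [S_{a,b}, A₁]Ω = S_{a,b+1}Ω + S_{a,b−1}Ω − S_{a+1,b}Ω − S_{a−1,b}Ω.
Δ : (ℕ → ℕ → ℚ) → ℕ → ℕ → ℚ
Δ g a b = (g a (suc b) + at-pred 0ℚ (g a) b) - (g (suc a) b + at-pred 0ℚ (λ j → g j b) a)

Δ-antisym : ∀ g → (∀ x y → g x y ≡ g y x) → ∀ a b → Δ g b a ≡ - Δ g a b
Δ-antisym g sym-g a b = begin
  (g b (suc a) + at-pred 0ℚ (g b) a) - (g (suc b) a + at-pred 0ℚ (λ j → g j a) b)
    ≡⟨ cong₂ _-_ (cong₂ _+_ (sym-g b (suc a)) (transpose a)) (cong₂ _+_ (sym-g (suc b) a) (transpose′ b)) ⟩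
  (g (suc a) b + at-pred 0ℚ (λ j → g j b) a) - (g a (suc b) + at-pred 0ℚ (g a) b)
    ≡⟨ solve 2 (λ x y → y :- x := :- (x :- y)) refl
               (g a (suc b) + at-pred 0ℚ (g a) b) (g (suc a) b + at-pred 0ℚ (λ j → g j b) a) ⟩
  - Δ g a b ∎
  where
  open ≡-Reasoning
  transpose : ∀ k → at-pred 0ℚ (g b) k ≡ at-pred 0ℚ (λ j → g j b) k
  transpose zero    = refl
  transpose (suc k) = sym-g b k
  transpose′ : ∀ k → at-pred 0ℚ (λ j → g j a) k ≡ at-pred 0ℚ (g a) k
  transpose′ zero    = refl
  transpose′ (suc k) = sym-g k a

-- The coordinates of √2 w_{k,k+1} = v_{k,k+1} − v_{k+1,k}.
∇ : (ℕ → ℕ → ℚ) → ℕ → ℚ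
∇ g k = Δ g k (suc k) - Δ g (suc k) k

telescoped : (ℕ → ℕ → ℚ) → ℕ → ℚ
telescoped g j = g j (suc (suc j)) + g (suc (suc j)) j + (h + h)
  where h = g 0 0 - g (suc j) (suc j)

∑-∇ : ∀ g j → ∑ (suc j) (∇ g) ≡ telescoped g j
∑-∇ g zero = solve 4 (λ a b c d →
    con 0ℚ :+ (((a :+ c) :- (d :+ con 0ℚ)) :- ((d :+ con 0ℚ) :- (b :+ c)))
      := a :+ b :+ ((c :- d) :+ (c :- d)))
  refl (g 0 2) (g 2 0) (g 0 0) (g 1 1)
∑-∇ g (suc j) = trans (cong (_+ ∇ g (suc j)) (∑-∇ g j)) (solve 7 (λ a b c d e f h →
    (a :+ b :+ ((c :- d) :+ (c :- d))) :+ (((e :+ d) :- (h :+ a)) :- ((h :+ b) :- (f :+ d)))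
      := e :+ f :+ ((c :- h) :+ (c :- h)))
  refl (g j (2 ℕ.+ j)) (g (2 ℕ.+ j) j) (g 0 0) (g (1 ℕ.+ j) (1 ℕ.+ j))
       (g (1 ℕ.+ j) (3 ℕ.+ j)) (g (3 ℕ.+ j) (1 ℕ.+ j)) (g (2 ℕ.+ j) (2 ℕ.+ j)))

telescoped-at : ∀ g j {a b c d} → g j (suc (suc j)) ≡ a → g (suc (suc j)) j ≡ b → g 0 0 ≡ c →
                g (suc j) (suc j) ≡ d → telescoped g j ≡ a + b + ((c - d) + (c - d))
telescoped-at g j refl refl refl refl = refl

δ-idem : ∀ j x → δ j x * δ j x ≡ δ j x
δ-idem j x with j ℕ.≡ᵇ x
... | true  = refl
... | false = refl

telescoped-far : ∀ {x y} j → 3 ℕ.+ x ≤ y → telescoped (δ₂ x y) j ≡ 0ℚ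
telescoped-far {x} {y} j 3+x≤y = telescoped-at (δ₂ x y) j
  (δ₂-off x y j (2 ℕ.+ j) λ { refl → ℕₚ.<⇒≢ 3+x≤y })
  (δ₂-off x y (2 ℕ.+ j) j λ { refl → ℕₚ.<⇒≢ (ℕₚ.≤-trans (ℕₚ.m≤n+m (suc j) 4) 3+x≤y) })
  (δ₂-off x y 0 0 λ { refl refl → ℕₚ.1+n≢0 (ℕₚ.n≤0⇒n≡0 3+x≤y) })
  (δ₂-off x y (1 ℕ.+ j) (1 ℕ.+ j) λ { refl → ℕₚ.<⇒≢ (ℕₚ.≤-trans (ℕₚ.m≤n+m (suc x) 2) 3+x≤y) })

telescoped-skew : ∀ x j → telescoped (δ₂ x (2 ℕ.+ x)) j ≡ δ j x
telescoped-skew x j with j ℕ.≟ x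
... | yes refl = trans (telescoped-at (δ₂ j (2 ℕ.+ j)) j (δ₂-diag j (2 ℕ.+ j))
                          (δ₂-off j (2 ℕ.+ j) (2 ℕ.+ j) j λ ())
                          (δ₂-off j (2 ℕ.+ j) 0 0 λ _ ())
                          (δ₂-off j (2 ℕ.+ j) (1 ℕ.+ j) (1 ℕ.+ j) λ ()))
                       (sym (δ-refl j))
... | no j≢x  = trans (telescoped-at (δ₂ x (2 ℕ.+ x)) j
                          (δ₂-off x (2 ℕ.+ x) j (2 ℕ.+ j) λ j≡x → ⊥-elim (j≢x j≡x))
                          (δ₂-off x (2 ℕ.+ x) (2 ℕ.+ j) j λ { refl → ℕₚ.m≢1+n+m j })
                          (δ₂-off x (2 ℕ.+ x) 0 0 λ _ ())
                          (δ₂-off x (2 ℕ.+ x) (1 ℕ.+ j) (1 ℕ.+ j) λ { refl → ℕₚ.m≢1+n+m (suc j) {1} }))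
                       (sym (δ-≢ j≢x))

telescoped-origin : ∀ j → telescoped (δ₂ 0 0) j ≡ 1ℚ + 1ℚ
telescoped-origin j = telescoped-at (δ₂ 0 0) j
  (δ₂-off 0 0 j (2 ℕ.+ j) λ _ ()) (δ₂-off 0 0 (2 ℕ.+ j) j λ ()) (δ₂-diag 0 0) (δ₂-off 0 0 (1 ℕ.+ j) (1 ℕ.+ j) λ ())

telescoped-diag : ∀ s j → telescoped (δ₂ (suc s) (suc s)) j ≡ - (δ j s + δ j s)
telescoped-diag s j = trans (telescoped-at (δ₂ (suc s) (suc s)) j
    (δ₂-off (suc s) (suc s) j (2 ℕ.+ j) λ { refl → ℕₚ.m≢1+n+m (suc s) {1} ∘ sym })
    (δ₂-off (suc s) (suc s) (2 ℕ.+ j) j λ { refl → ℕₚ.m≢1+n+m j {1} })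
    (δ₂-off (suc s) (suc s) 0 0 λ ())
    (δ-idem j s))
  (solve 1 (λ d → con 0ℚ :+ con 0ℚ :+ ((con 0ℚ :- d) :+ (con 0ℚ :- d)) := :- (d :+ d)) refl (δ j s))

telescoped-sym : ∀ x y j → telescoped (δ₂ x y) j ≡ telescoped (δ₂ y x) j
telescoped-sym x y j = trans
  (telescoped-at (δ₂ x y) j (δ₂-swap x y j (2 ℕ.+ j)) (δ₂-swap x y (2 ℕ.+ j) j)
                 (δ₂-swap x y 0 0) (δ₂-swap x y (1 ℕ.+ j) (1 ℕ.+ j)))
  (cong (_+ (h + h)) (ℚₚ.+-comm (δ₂ y x (2 ℕ.+ j) j) (δ₂ y x j (2 ℕ.+ j))))
  where h = δ₂ y x 0 0 - δ₂ y x (1 ℕ.+ j) (1 ℕ.+ j)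

∑-telescoped-far : ∀ m {x y} → 3 ℕ.+ x ≤ y → ∑ m (telescoped (δ₂ x y)) ≡ 0ℚ
∑-telescoped-far m 3+x≤y = ∑-zero m (λ j _ → telescoped-far j 3+x≤y)

∑-telescoped-skew : ∀ m x → x < m → ∑ m (telescoped (δ₂ x (2 ℕ.+ x))) ≡ 1ℚ
∑-telescoped-skew m x x<m = begin
  ∑ m (telescoped (δ₂ x (2 ℕ.+ x)))  ≡⟨ ∑-cong m (λ j _ → telescoped-skew x j) ⟩
  ∑ m (λ j → δ j x)                  ≡⟨ ∑-single m x x<m (λ j _ j≢x → δ-≢ j≢x) ⟩
  δ x x                              ≡⟨ δ-refl x ⟩
  1ℚ                                 ∎
  where open ≡-Reasoning

∑-telescoped-origin : ∀ m → ∑ m (telescoped (δ₂ 0 0)) ≡ ι m * (1ℚ + 1ℚ)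
∑-telescoped-origin m = trans (∑-cong m (λ j _ → telescoped-origin j)) (∑-const m (1ℚ + 1ℚ))

∑-telescoped-diag : ∀ m s → s < m → ∑ m (telescoped (δ₂ (suc s) (suc s))) ≡ - (1ℚ + 1ℚ)
∑-telescoped-diag m s s<m = begin
  ∑ m (telescoped (δ₂ (suc s) (suc s)))  ≡⟨ ∑-cong m (λ j _ → telescoped-diag s j) ⟩
  ∑ m (λ j → - (δ j s + δ j s))          ≡⟨ ∑-single m s s<m (λ j _ j≢s → cong (λ d → - (d + d)) (δ-≢ j≢s)) ⟩
  - (δ s s + δ s s)                      ≡⟨ cong (λ d → - (d + d)) (δ-refl s) ⟩
  - (1ℚ + 1ℚ)                            ∎
  where open ≡-Reasoning

-- Admissible pairs

odd-successor⇒even : ∀ k → suc k % 2 ≡ 1 → ∃ λ d → k ≡ d ℕ.+ d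
odd-successor⇒even zero             _   = 0 , refl
odd-successor⇒even (suc zero)       ()
odd-successor⇒even (suc (suc k)) odd with odd-successor⇒even k
  (trans (sym ([m+n]%n≡m%n (suc k) 2)) (trans (cong (_% 2) (ℕₚ.+-comm (suc k) 2)) odd))
... | d , k≡d+d = suc d , cong suc (trans (cong suc k≡d+d) (sym (ℕₚ.+-suc d d)))

halve-≤ : ∀ k j → k ℕ.+ suc k ≤ j ℕ.+ suc j → k ≤ j
halve-≤ k j le with k ℕ.≤? j
... | yes k≤j = k≤j
... | no  k≰j = ⊥-elim (ℕₚ.<⇒≱ (ℕₚ.+-mono-< j<k (s≤s j<k)) le)
  where j<k = ℕₚ.≰⇒> k≰j

odd-gap : ∀ a k → (a ℕ.+ suc (a ℕ.+ k)) % 2 ≡ 1 → suc k % 2 ≡ 1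
odd-gap a k odd = trans (sym ([m+kn]%n≡m%n (suc k) a 2)) (trans (cong (_% 2) (sum-shape a k)) odd)
  where
  sum-shape : ∀ a k → suc k ℕ.+ a ℕ.* 2 ≡ a ℕ.+ suc (a ℕ.+ k)
  sum-shape = solve-∀

admissible-shape : ∀ {m a b} → 1 ≤ m → a < b → (a ℕ.+ b) % 2 ≡ 1 → a ℕ.+ b ≤ 2 ℕ.* m ∸ 1 →
                   ∃ λ d → b ≡ suc (d ℕ.+ d ℕ.+ a) × a ℕ.+ d < m
admissible-shape {suc m′} {a} {b} _ a<b odd bound
  with k , refl ← ℕₚ.m≤n⇒∃[o]m+o≡n a<b
  with d , refl ← odd-successor⇒even k (odd-gap a k odd)
  = d , cong suc (ℕₚ.+-comm a (d ℕ.+ d)) , s≤s (halve-≤ (a ℕ.+ d) m′ (subst (_≤ m′ ℕ.+ suc m′) (double-shape a d) bound′))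
  where
  double-shape : ∀ a d → a ℕ.+ suc (a ℕ.+ (d ℕ.+ d)) ≡ a ℕ.+ d ℕ.+ suc (a ℕ.+ d)
  double-shape = solve-∀
  bound′ : a ℕ.+ suc (a ℕ.+ (d ℕ.+ d)) ≤ m′ ℕ.+ suc m′
  bound′ = subst (a ℕ.+ suc (a ℕ.+ (d ℕ.+ d)) ≤_) (cong (λ t → m′ ℕ.+ suc t) (ℕₚ.+-identityʳ m′)) bound

adjacent-admissible : ∀ {m a} → a < m → (a < suc a) × ((a ℕ.+ suc a) % 2 ≡ 1) × (a ℕ.+ suc a ≤ 2 ℕ.* m ∸ 1)
adjacent-admissible {suc m′} {a} (s≤s a≤m′) =
  ℕₚ.n<1+n a ,
  trans (cong (_% 2) (sum-shape a)) ([m+kn]%n≡m%n 1 a 2) ,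
  ℕₚ.+-mono-≤ a≤m′ (s≤s (subst (a ≤_) (sym (ℕₚ.+-identityʳ m′)) a≤m′))
  where
  sum-shape : ∀ a → a ℕ.+ suc a ≡ 1 ℕ.+ a ℕ.* 2
  sum-shape = solve-∀

-- The vectors S_{a,b}Ω

module Grid {n : ℕ} (o : Fin n) (p : Fin n × ℕ) (ps : List (Fin n × ℕ))
            (pos : AllPos (p ∷ ps)) (alt : Alternating (p ∷ ps))
            (first≢o : proj₁ p ≢ o) (last≢o : proj₁ (lastOf p ps) ≢ o) where

  S : List (Fin n × ℕ)
  S = p ∷ ps

  gridWord : ℕ → ℕ → Word n
  gridWord a b = replicate a o ++ blocks S (replicate b o)

  basis : ℕ → ℕ → FVec n
  basis a b = single (gridWord a b)

  blocks-fresh : ∀ w → NotHeadedBy o (blocks S w)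
  blocks-fresh w = blocks-not-headed ps w (proj₁ pos) first≢o

  gridWord-injective : ∀ a b a′ b′ → gridWord a b ≡ gridWord a′ b′ → a ≡ a′ × b ≡ b′
  gridWord-injective a b a′ b′ e with replicate-prefix-injective o a a′ (blocks-fresh _) (blocks-fresh _) e
  ... | a≡a′ , e′ = a≡a′ , replicate-injective o (blocks-cancel S e′)

  coeff-basis : ∀ a b x y → coeff (basis a b) (gridWord x y) ≡ δ₂ x y a b
  coeff-basis a b x y with gridWord a b ≟w gridWord x y
  ... | yes e with gridWord-injective a b x y e
  ...   | refl , refl = sym (δ₂-diag a b)
  coeff-basis a b x y | no ne = sym (δ₂-off x y a b λ { refl refl → ne refl })

  -- Since S neither begins nor ends with a power of A₁, each P_k(A₁) acts on a tensor that does not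
  -- start with e₁, where it simply prepends e₁^{⊗k}.
  Sop-Ω : ∀ a b → Sop o S a b Ω ≋ basis a b
  Sop-Ω a b = begin
    P a (A o) (applyS S (P b (A o) (single [])))
      ≈⟨ resp-≋ (∘-linear (P-linear a (A-linear o)) (applyS-linear S)) (P-single o b _) ⟩
    P a (A o) (applyS S (single (replicate b o ++ [])))
      ≡⟨ cong (λ w → P a (A o) (applyS S (single w))) (Listₚ.++-identityʳ (replicate b o)) ⟩
    P a (A o) (applyS S (single (replicate b o)))
      ≈⟨ resp-≋ (P-linear a (A-linear o)) (applyS-single p ps pos alt (last-fresh b)) ⟩
    P a (A o) (single (blocks S (replicate b o)))
      ≈⟨ P-single o a (blocks-fresh _) ⟩
    basis a b ∎
    where
    open import Relation.Binary.Reasoning.Setoid ≋-setoid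
    last-fresh : ∀ b → NotHeadedBy (proj₁ (lastOf p ps)) (replicate b o)
    last-fresh zero    = _
    last-fresh (suc b) = last≢o ∘ sym

  ΔV : ℕ → ℕ → FVec n
  ΔV a b = (basis a (suc b) ⊕ at-pred [] (basis a) b) ⊖ (basis (suc a) b ⊕ at-pred [] (λ j → basis j b) a)

  vv-ΔV : ∀ a b → vv o S a b ≋ ΔV a b
  vv-ΔV a b = ⊖-cong right-action left-action
    where
    open import Relation.Binary.Reasoning.Setoid ≋-setoid
    outer : ∀ a → IsLinear (λ v → P a (A o) (applyS S v))
    outer a = ∘-linear (P-linear a (A-linear o)) (applyS-linear S)

    right-action : Sop o S a b (A o Ω) ≋ basis a (suc b) ⊕ at-pred [] (basis a) b
    right-action = begin
      P a (A o) (applyS S (P b (A o) (A o Ω)))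
        ≈⟨ resp-≋ (outer a) (≋-trans (P-comm (A-linear o) b Ω) (P-recurrence (A-linear o) b Ω)) ⟩
      P a (A o) (applyS S (P (suc b) (A o) Ω ⊕ at-pred [] (λ j → P j (A o) Ω) b))
        ≈⟨ ⊕-homo (outer a) _ _ ⟩
      Sop o S a (suc b) Ω ⊕ P a (A o) (applyS S (at-pred [] (λ j → P j (A o) Ω) b))
        ≈⟨ ⊕-cong (Sop-Ω a (suc b)) (at-pred-linear (outer a) (λ j → P j (A o) Ω) b) ⟩
      basis a (suc b) ⊕ at-pred [] (λ j → Sop o S a j Ω) b
        ≈⟨ ⊕-cong (≋-refl {x = basis a (suc b)}) (at-pred-cong b (Sop-Ω a)) ⟩
      basis a (suc b) ⊕ at-pred [] (basis a) b ∎

    left-action : A o (Sop o S a b Ω) ≋ basis (suc a) b ⊕ at-pred [] (λ j → basis j b) a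
    left-action = ≋-trans (P-recurrence (A-linear o) a (applyS S (P b (A o) Ω)))
                          (⊕-cong (Sop-Ω (suc a) b) (at-pred-cong a (λ j → Sop-Ω j b)))

  u-ΔV : ∀ a b → u o S a b ≋ ΔV a b ⊖ ΔV b a
  u-ΔV a b = ⊖-cong (vv-ΔV a b) (vv-ΔV b a)

  ΔV-value : ∀ (L : FVec n → ℚ) g → (∀ x y → L (x ⊕ y) ≡ L x + L y) → (∀ x y → L (x ⊖ y) ≡ L x - L y) →
             L [] ≡ 0ℚ → (∀ x y → L (basis x y) ≡ g x y) → ∀ a b → L (ΔV a b) ≡ Δ g a b
  ΔV-value L g L-⊕ L-⊖ L-[] L-basis a b =
    trans (L-⊖ _ _) (cong₂ _-_
      (trans (L-⊕ _ _) (cong₂ _+_ (L-basis a (suc b)) (at-pred-value b (L-basis a))))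
      (trans (L-⊕ _ _) (cong₂ _+_ (L-basis (suc a) b) (at-pred-value a (λ j → L-basis j b)))))
    where
    at-pred-value : ∀ {f : ℕ → FVec n} {h : ℕ → ℚ} k → (∀ j → L (f j) ≡ h j) → L (at-pred [] f k) ≡ at-pred 0ℚ h k
    at-pred-value zero    _ = L-[]
    at-pred-value (suc k) e = e k

  coeff-sumK : ∀ f k w → coeff (sumK o S f k) w ≡ ∑ k (λ i → coeff (f i) w)
  coeff-sumK f zero    w = refl
  coeff-sumK f (suc k) w = trans (coeff-⊕ (sumK o S f k) (f k) w) (cong (_+ coeff (f k) w) (coeff-sumK f k w))

  coeff-u : ∀ a b x y → coeff (u o S a b) (gridWord x y) ≡ Δ (δ₂ x y) a b - Δ (δ₂ x y) b a
  coeff-u a b x y = trans (coeff-≡ (u-ΔV a b) w) (trans (coeff-⊖ (ΔV a b) (ΔV b a) w) (cong₂ _-_ (value a b) (value b a)))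
    where
    w = gridWord x y
    value : ∀ a b → coeff (ΔV a b) w ≡ Δ (δ₂ x y) a b
    value = ΔV-value (λ v → coeff v w) (δ₂ x y) (λ v v′ → coeff-⊕ v v′ w) (λ v v′ → coeff-⊖ v v′ w) refl
                     (λ p q → coeff-basis p q x y)

  inner-u : ∀ (R : FVec n) a b → inner R (u o S a b) ≡ Δ (λ x y → coeff R (gridWord x y)) a b
                                                       - Δ (λ x y → coeff R (gridWord x y)) b a
  inner-u R a b = trans (inner-respʳ R (u-ΔV a b)) (trans (inner-⊖ʳ R (ΔV a b) (ΔV b a)) (cong₂ _-_ (value a b) (value b a)))
    where
    value : ∀ a b → inner R (ΔV a b) ≡ Δ (λ x y → coeff R (gridWord x y)) a b
    value = ΔV-value (inner R) _ (inner-⊕ʳ R) (inner-⊖ʳ R) (inner-[]ʳ R) (λ x y → inner-singleʳ R (gridWord x y))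

  module Projection (m : ℕ) (1≤m : 1 ≤ m) where

    c₀ : ℚ
    c₀ = ℤ.+ 1 / suc (suc (suc (2 ℕ.* m)))

    c₀-inverse : c₀ * (1ℚ + (1ℚ + (1ℚ + (ι m + ι m)))) ≡ 1ℚ
    c₀-inverse = trans (cong (c₀ *_) (sym ι[2m+3])) (ι-inverse (suc (suc (2 ℕ.* m))))
      where
      ι[2m+3] : ι (suc (suc (suc (2 ℕ.* m)))) ≡ 1ℚ + (1ℚ + (1ℚ + (ι m + ι m)))
      ι[2m+3] = begin
        ι (3 ℕ.+ 2 ℕ.* m)                    ≡⟨ ι-suc (2 ℕ.+ 2 ℕ.* m) ⟩
        1ℚ + ι (2 ℕ.+ 2 ℕ.* m)               ≡⟨ cong (1ℚ +_) (ι-suc (1 ℕ.+ 2 ℕ.* m)) ⟩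
        1ℚ + (1ℚ + ι (1 ℕ.+ 2 ℕ.* m))        ≡⟨ cong (λ t → 1ℚ + (1ℚ + t)) (ι-suc (2 ℕ.* m)) ⟩
        1ℚ + (1ℚ + (1ℚ + ι (2 ℕ.* m)))       ≡⟨ cong (λ t → 1ℚ + (1ℚ + (1ℚ + t))) (ι-double m) ⟩
        1ℚ + (1ℚ + (1ℚ + (ι m + ι m)))       ∎
        where
        open ≡-Reasoning
        ι-double : ∀ k → ι (2 ℕ.* k) ≡ ι k + ι k
        ι-double k = trans (ι-+ k (k ℕ.+ 0)) (cong (λ j → ι k + ι j) (ℕₚ.+-identityʳ k))

    coeff-sm : ∀ w → coeff (sm o S m) w ≡ c₀ * ∑ m (λ k → ι (m ∸ k) * coeff (u o S k (suc k)) w)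
    coeff-sm w = trans (coeff-scale c₀ (sumK o S term m) w) (cong (c₀ *_) (trans (coeff-sumK term m w)
                   (∑-cong m (λ k _ → coeff-scale (ι (m ∸ k)) (u o S k (suc k)) w))))
      where
      term : ℕ → FVec n
      term k = scale (ι (m ∸ k)) (u o S k (suc k))

    coeff-sm-grid : ∀ x y → coeff (sm o S m) (gridWord x y) ≡ c₀ * ∑ m (telescoped (δ₂ x y))
    coeff-sm-grid x y = trans (coeff-sm (gridWord x y)) (cong (c₀ *_) (begin
      ∑ m (λ k → ι (m ∸ k) * coeff (u o S k (suc k)) (gridWord x y))
        ≡⟨ ∑-cong m (λ k _ → cong (ι (m ∸ k) *_) (coeff-u k (suc k) x y)) ⟩
      ∑ m (λ k → ι (m ∸ k) * ∇ (δ₂ x y) k)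
        ≡⟨ ∑-weighted m (∇ (δ₂ x y)) ⟩
      ∑ m (λ j → ∑ (suc j) (∇ (δ₂ x y)))
        ≡⟨ ∑-cong m (λ j _ → ∑-∇ (δ₂ x y) j) ⟩
      ∑ m (telescoped (δ₂ x y)) ∎))
      where open ≡-Reasoning

    R : FVec n
    R = SΩ o S ⊖ sm o S m

    ρ : ℕ → ℕ → ℚ
    ρ x y = coeff R (gridWord x y)

    ρ-formula : ∀ x y → ρ x y ≡ δ₂ x y 0 0 - c₀ * ∑ m (telescoped (δ₂ x y))
    ρ-formula x y = trans (coeff-⊖ (SΩ o S) (sm o S m) (gridWord x y))
                          (cong₂ _-_ (trans (coeff-≡ (Sop-Ω 0 0) (gridWord x y)) (coeff-basis 0 0 x y)) (coeff-sm-grid x y))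

    ρ-sym : ∀ x y → ρ x y ≡ ρ y x
    ρ-sym x y = trans (ρ-formula x y) (trans
      (cong₂ (λ d t → d - c₀ * t) (δ₂-swap x y 0 0) (∑-cong m (λ j _ → telescoped-sym x y j)))
      (sym (ρ-formula y x)))

    ρ-far : ∀ {x y} → 3 ℕ.+ x ≤ y → ρ x y ≡ 0ℚ
    ρ-far {x} {y} 3+x≤y = begin
      ρ x y                                       ≡⟨ ρ-formula x y ⟩
      δ₂ x y 0 0 - c₀ * ∑ m (telescoped (δ₂ x y)) ≡⟨ cong₂ (λ d t → d - c₀ * t) off-origin (∑-telescoped-far m 3+x≤y) ⟩
      0ℚ - c₀ * 0ℚ                                ≡⟨ solve 1 (λ c → con 0ℚ :- c :* con 0ℚ := con 0ℚ) refl c₀ ⟩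
      0ℚ                                          ∎
      where
      open ≡-Reasoning
      off-origin = δ₂-off x y 0 0 λ { refl refl → ℕₚ.1+n≢0 (ℕₚ.n≤0⇒n≡0 3+x≤y) }

    ρ-skew : ∀ x → x < m → ρ x (2 ℕ.+ x) ≡ - c₀
    ρ-skew x x<m = begin
      ρ x (2 ℕ.+ x)       ≡⟨ ρ-formula x (2 ℕ.+ x) ⟩
      δ₂ x (2 ℕ.+ x) 0 0 - c₀ * ∑ m (telescoped (δ₂ x (2 ℕ.+ x)))
        ≡⟨ cong₂ (λ d t → d - c₀ * t) (δ₂-off x (2 ℕ.+ x) 0 0 λ _ ()) (∑-telescoped-skew m x x<m) ⟩
      0ℚ - c₀ * 1ℚ        ≡⟨ solve 1 (λ c → con 0ℚ :- c :* con 1ℚ := :- c) refl c₀ ⟩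
      - c₀                ∎
      where open ≡-Reasoning

    ρ-origin : ρ 0 0 ≡ c₀ + c₀ + c₀
    ρ-origin = begin
      ρ 0 0               ≡⟨ ρ-formula 0 0 ⟩
      δ₂ 0 0 0 0 - c₀ * ∑ m (telescoped (δ₂ 0 0))
        ≡⟨ cong₂ (λ d t → d - c₀ * t) (sym c₀-inverse) (∑-telescoped-origin m) ⟩
      c₀ * (1ℚ + (1ℚ + (1ℚ + (ι m + ι m)))) - c₀ * (ι m * (1ℚ + 1ℚ))
        ≡⟨ solve 2 (λ c i → c :* (con 1ℚ :+ (con 1ℚ :+ (con 1ℚ :+ (i :+ i)))) :- c :* (i :* (con 1ℚ :+ con 1ℚ))
                            := c :+ c :+ c) refl c₀ (ι m) ⟩
      c₀ + c₀ + c₀        ∎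
      where open ≡-Reasoning

    ρ-diag : ∀ s → s < m → ρ (suc s) (suc s) ≡ c₀ + c₀
    ρ-diag s s<m = begin
      ρ (suc s) (suc s)   ≡⟨ ρ-formula (suc s) (suc s) ⟩
      δ₂ (suc s) (suc s) 0 0 - c₀ * ∑ m (telescoped (δ₂ (suc s) (suc s)))
        ≡⟨ cong₂ (λ d t → d - c₀ * t) (δ₂-off (suc s) (suc s) 0 0 λ ()) (∑-telescoped-diag m s s<m) ⟩
      0ℚ - c₀ * - (1ℚ + 1ℚ)
        ≡⟨ solve 1 (λ c → con 0ℚ :- c :* (:- (con 1ℚ :+ con 1ℚ)) := c :+ c) refl c₀ ⟩
      c₀ + c₀             ∎
      where open ≡-Reasoning

    Balanced : ℕ → ℕ → Set
    Balanced a b = ρ a (suc b) + at-pred 0ℚ (ρ a) b ≡ ρ (suc a) b + at-pred 0ℚ (λ j → ρ j b) a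

    balanced : ∀ a d → a ℕ.+ d < m → Balanced a (suc (d ℕ.+ d ℕ.+ a))
    balanced zero zero 0<m = begin
      ρ 0 2 + ρ 0 0             ≡⟨ cong₂ _+_ (ρ-skew 0 0<m) ρ-origin ⟩
      - c₀ + (c₀ + c₀ + c₀)     ≡⟨ solve 1 (λ c → :- c :+ (c :+ c :+ c) := (c :+ c) :+ con 0ℚ) refl c₀ ⟩
      (c₀ + c₀) + 0ℚ            ≡⟨ cong (_+ 0ℚ) (sym (ρ-diag 0 0<m)) ⟩
      ρ 1 1 + 0ℚ                ∎
      where open ≡-Reasoning
    balanced (suc s) zero s+1+0<m = begin
      ρ (1 ℕ.+ s) (3 ℕ.+ s) + ρ (1 ℕ.+ s) (1 ℕ.+ s) ≡⟨ cong₂ _+_ (ρ-skew (suc s) s+1<m) (ρ-diag s s<m) ⟩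
      - c₀ + (c₀ + c₀)                              ≡⟨ solve 1 (λ c → :- c :+ (c :+ c) := (c :+ c) :+ :- c) refl c₀ ⟩
      (c₀ + c₀) + - c₀                              ≡⟨ sym (cong₂ _+_ (ρ-diag (suc s) s+1<m) (ρ-skew s s<m)) ⟩
      ρ (2 ℕ.+ s) (2 ℕ.+ s) + ρ s (2 ℕ.+ s)         ∎
      where
      open ≡-Reasoning
      s+1<m = subst (_< m) (ℕₚ.+-identityʳ (suc s)) s+1+0<m
      s<m   = ℕₚ.<-trans (ℕₚ.n<1+n s) s+1<m
    balanced a (suc zero) a+1<m = begin
      ρ a (4 ℕ.+ a) + ρ a (2 ℕ.+ a)            ≡⟨ cong₂ _+_ (ρ-far (ℕₚ.n≤1+n (3 ℕ.+ a))) (ρ-skew a a<m) ⟩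
      0ℚ + - c₀                                ≡⟨ ℚₚ.+-comm 0ℚ (- c₀) ⟩
      - c₀ + 0ℚ                                ≡⟨ sym (cong₂ _+_ (ρ-skew (suc a) 1+a<m) (below-far a)) ⟩
      ρ (1 ℕ.+ a) (3 ℕ.+ a) + at-pred 0ℚ (λ j → ρ j (3 ℕ.+ a)) a ∎
      where
      open ≡-Reasoning
      1+a<m = subst (_< m) (ℕₚ.+-comm a 1) a+1<m
      a<m   = ℕₚ.<-trans (ℕₚ.n<1+n a) 1+a<m
      below-far : ∀ a → at-pred 0ℚ (λ j → ρ j (3 ℕ.+ a)) a ≡ 0ℚ
      below-far zero    = refl
      below-far (suc s) = ρ-far (ℕₚ.n≤1+n (3 ℕ.+ s))
    balanced a (suc (suc d)) _ =
      trans (cong₂ _+_ (ρ-far (ℕₚ.≤-trans 3+a≤c (ℕₚ.≤-trans (ℕₚ.n≤1+n c) (ℕₚ.n≤1+n (suc c))))) (ρ-far 3+a≤c))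
            (sym (cong₂ _+_ (ρ-far (s≤s 3+a≤c)) (below-far a 3+a≤c)))
      where
      c = suc (suc d) ℕ.+ suc (suc d) ℕ.+ a
      3+a≤c : 3 ℕ.+ a ≤ c
      3+a≤c = ℕₚ.+-monoˡ-≤ a (s≤s (s≤s (ℕₚ.≤-trans (s≤s z≤n) (ℕₚ.m≤n+m (suc (suc d)) d))))
      below-far : ∀ a → 3 ℕ.+ a ≤ c → at-pred 0ℚ (λ j → ρ j (suc c)) a ≡ 0ℚ
      below-far zero    _     = refl
      below-far (suc s) 4+s≤c = ρ-far (ℕₚ.≤-trans (ℕₚ.n≤1+n (3 ℕ.+ s)) (ℕₚ.≤-trans 4+s≤c (ℕₚ.n≤1+n c)))

    Δρ-admissible : ∀ {a b} → Adm o S m a b → Δ ρ a b ≡ 0ℚ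
    Δρ-admissible {a} (a<b , odd , bound) with admissible-shape 1≤m a<b odd bound
    ... | d , refl , a+d<m = trans (cong (_- lower) (balanced a d a+d<m)) (ℚₚ.+-inverseʳ lower)
      where
      b = suc (d ℕ.+ d ℕ.+ a)
      lower = ρ (suc a) b + at-pred 0ℚ (λ j → ρ j b) a

    residual-perpendicular : PerpW o S m R
    residual-perpendicular a b adm = begin
      inner R (u o S a b)       ≡⟨ inner-u R a b ⟩
      Δ ρ a b - Δ ρ b a         ≡⟨ cong (λ t → Δ ρ a b - t) (Δ-antisym ρ ρ-sym a b) ⟩
      Δ ρ a b - - Δ ρ a b       ≡⟨ cong (λ t → t - - t) (Δρ-admissible adm) ⟩
      0ℚ                        ∎
      where open ≡-Reasoning

    κ : ℕ → ℚ
    κ a = c₀ * ι (m ∸ a)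

    κ-vanishes : ∀ {a} → m ≤ a → κ a ≡ 0ℚ
    κ-vanishes m≤a = trans (cong (λ k → c₀ * ι k) (ℕₚ.m≤n⇒m∸n≡0 m≤a)) (ℚₚ.*-zeroʳ c₀)

    -- s_m = Σ_a κ a · √2 w_{a,a+1}, so these are its coordinates along the spanning family.
    coordinates : ℕ → ℕ → ℚ
    coordinates a b = δ (suc a) b * κ a

    coordinates-admissible : ∀ a b → ¬ Adm o S m a b → coordinates a b ≡ 0ℚ
    coordinates-admissible a b not-adm with suc a ℕ.≟ b
    ... | no 1+a≢b = trans (cong (_* κ a) (δ-≢ 1+a≢b)) (ℚₚ.*-zeroˡ (κ a))
    ... | yes refl with a ℕ.<? m
    ...   | yes a<m = ⊥-elim (not-adm (adjacent-admissible a<m))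
    ...   | no  a≮m = trans (cong (δ (suc a) (suc a) *_) (κ-vanishes (ℕₚ.≮⇒≥ a≮m))) (ℚₚ.*-zeroʳ (δ (suc a) (suc a)))

    module _ (w : Word n) where

      U : ℕ → ℕ → ℚ
      U a b = coeff (u o S a b) w

      row-sum : ∀ a → ∑ (2 ℕ.* m) (λ b → coordinates a b * U a b) ≡ κ a * U a (suc a)
      row-sum a with a ℕ.<? m
      ... | yes a<m = trans
        (∑-single (2 ℕ.* m) (suc a) (ℕₚ.≤-<-trans a<m (ℕₚ.m<m+n m (ℕₚ.≤-trans 1≤m (ℕₚ.m≤m+n m 0))))
          (λ b _ b≢1+a → trans (cong (λ d → d * κ a * U a b) (δ-≢ (b≢1+a ∘ sym)))
                               (solve 2 (λ k t → con 0ℚ :* k :* t := con 0ℚ) refl (κ a) (U a b))))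
        (trans (cong (λ d → d * κ a * U a (suc a)) (δ-refl a)) (cong (_* U a (suc a)) (ℚₚ.*-identityˡ (κ a))))
      ... | no a≮m = trans
        (∑-zero (2 ℕ.* m) (λ b _ → trans (cong (λ k → δ (suc a) b * k * U a b) κ₀)
                                          (solve 2 (λ d t → d :* con 0ℚ :* t := con 0ℚ) refl (δ (suc a) b) (U a b))))
        (sym (trans (cong (_* U a (suc a)) κ₀) (ℚₚ.*-zeroˡ (U a (suc a)))))
        where κ₀ = κ-vanishes (ℕₚ.≮⇒≥ a≮m)

      coeff-combo : coeff (combo o S m coordinates) w ≡ coeff (sm o S m) w
      coeff-combo = begin
        coeff (combo o S m coordinates) w
          ≡⟨ trans (coeff-sumK _ (2 ℕ.* m) w) (∑-cong (2 ℕ.* m) (λ a _ → trans (coeff-sumK _ (2 ℕ.* m) w)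
               (∑-cong (2 ℕ.* m) (λ b _ → coeff-scale (coordinates a b) (u o S a b) w)))) ⟩
        ∑ (2 ℕ.* m) (λ a → ∑ (2 ℕ.* m) (λ b → coordinates a b * U a b))
          ≡⟨ ∑-cong (2 ℕ.* m) (λ a _ → row-sum a) ⟩
        ∑ (2 ℕ.* m) (λ a → κ a * U a (suc a))
          ≡⟨ cong (λ k → ∑ k (λ a → κ a * U a (suc a))) (cong (m ℕ.+_) (ℕₚ.+-identityʳ m)) ⟩
        ∑ (m ℕ.+ m) (λ a → κ a * U a (suc a))
          ≡⟨ ∑-truncate m m (λ a m≤a → trans (cong (_* U a (suc a)) (κ-vanishes m≤a)) (ℚₚ.*-zeroˡ (U a (suc a)))) ⟩
        ∑ m (λ a → κ a * U a (suc a))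
          ≡⟨ ∑-cong m (λ a _ → ℚₚ.*-assoc c₀ (ι (m ∸ a)) (U a (suc a))) ⟩
        ∑ m (λ a → c₀ * (ι (m ∸ a) * U a (suc a)))
          ≡⟨ ∑-scale m c₀ (λ a → ι (m ∸ a) * U a (suc a)) ⟩
        c₀ * ∑ m (λ a → ι (m ∸ a) * U a (suc a))
          ≡⟨ sym (coeff-sm w) ⟩
        coeff (sm o S m) w ∎
        where open ≡-Reasoning

    sm∈W : InW o S m (sm o S m)
    sm∈W = coordinates , coordinates-admissible , λ w → sym (coeff-combo w)

    sm-is-projection : IsOrthProj o S m (SΩ o S) (sm o S m)
    sm-is-projection = sm∈W , residual-perpendicular

proposition7p4p4 : (n : ℕ) → (h : 2 ≤ n) →
    (p : Fin n × ℕ) → (ps : List (Fin n × ℕ)) →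
    AllPos (p ∷ ps) → Alternating (p ∷ ps) →
    proj₁ p ≢ fromℕ< (≤-trans (s≤s z≤n) h) →
    proj₁ (lastOf p ps) ≢ fromℕ< (≤-trans (s≤s z≤n) h) →
    (m : ℕ) → 1 ≤ m →
    IsOrthProj (fromℕ< (≤-trans (s≤s z≤n) h)) (p ∷ ps) m
      (SΩ (fromℕ< (≤-trans (s≤s z≤n) h)) (p ∷ ps))
      (sm (fromℕ< (≤-trans (s≤s z≤n) h)) (p ∷ ps) m)
proposition7p4p4 n h p ps pos alt first≢e₁ last≢e₁ m 1≤m =
  Grid.Projection.sm-is-projection (fromℕ< (≤-trans (s≤s z≤n) h)) p ps pos alt first≢e₁ last≢e₁ m 1≤m
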